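{- Let $G$ be a $2$-connected graph on $n\geq 5$ vertices. Then $F(G)\geq F(C_n)$, with equality if and only if $G$ is isomorphic to $C_n$.
   Context: All graphs are finite, simple and undirected. A graph is $2$-connected if it is connected, has at least three vertices and has no cut-vertex. $C_n$ is the cycle on $n$ vertices. A connected subgraph of a graph $G=(V,E)$ is a graph $(V',E')$ with $\emptyset\neq V'\subseteq V$, $E'\subseteq E$, every edge of $E'$ having both endpoints in $V'$, and $(V',E')$ connected; distinct pairs $(V',E')$ are counted separately. The core index $F(G)$ is the number of connected subgraphs of $G$. -}

module Defs where

open import Level using (0ℓ)
open import Data.Nat using (ℕ; suc; _∸_; _≡ᵇ_)
open import Data.Bool using (Bool; true; false; _∧_; _∨_; not)
open import Data.Fin using (Fin; toℕ; _≟_)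
open import Data.Fin.Permutation using (Permutation′; _⟨$⟩ʳ_)
open import Data.Product using (Σ; ∃; _×_)
open import Relation.Nullary.Decidable using (⌊_⌋)
open import Relation.Binary.Bundles using (Setoid)
open import Relation.Binary.PropositionalEquality as ≡ using (_≡_; refl; sym; trans)
open import Function.Bundles using (Inverse)

Graph : ℕ → Set
Graph n = Fin n → Fin n → Bool

IsSimple : ∀ {n} → Graph n → Set
IsSimple {n} G = (∀ (i j : Fin n) → G i j ≡ G j i) × (∀ (i : Fin n) → G i i ≡ false)

data Walk {n : ℕ} (P : Graph n) : Fin n → Fin n → Set where
  here : ∀ {u} → Walk P u u
  step : ∀ {u w v} → P u w ≡ true → Walk P w v → Walk P u v

Connected : ∀ {n} → Graph n → Set
Connected {n} G = ∀ (u v : Fin n) → Walk G u v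

deleteVertex : ∀ {n} → Graph n → Fin n → Graph n
deleteVertex G x i j = G i j ∧ not ⌊ x ≟ i ⌋ ∧ not ⌊ x ≟ j ⌋

ConnectedWithout : ∀ {n} → Graph n → Fin n → Set
ConnectedWithout {n} G x =
  ∀ (u v : Fin n) → ¬≡ x u → ¬≡ x v → Walk (deleteVertex G x) u v
  where
  ¬≡ : Fin n → Fin n → Set
  ¬≡ a b = ⌊ a ≟ b ⌋ ≡ false

TwoConnected : ∀ {n} → Graph n → Set
TwoConnected {n} G = (3 Data.Nat.≤ n) × Connected G × (∀ (x : Fin n) → ConnectedWithout G x)

cycle : (n : ℕ) → Graph n
cycle n i j =
  (suc (toℕ i) ≡ᵇ toℕ j) ∨ (suc (toℕ j) ≡ᵇ toℕ i)
  ∨ ((toℕ i ≡ᵇ 0) ∧ (toℕ j ≡ᵇ (n ∸ 1)))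
  ∨ ((toℕ j ≡ᵇ 0) ∧ (toℕ i ≡ᵇ (n ∸ 1)))

_≅_ : ∀ {n} → Graph n → Graph n → Set
_≅_ {n} G H = Σ (Permutation′ n) λ σ → ∀ (i j : Fin n) → G i j ≡ H (σ ⟨$⟩ʳ i) (σ ⟨$⟩ʳ j)

record ConnSub {n : ℕ} (G : Graph n) : Set where
  field
    V'       : Fin n → Bool
    E'       : Graph n
    E'-sym   : ∀ i j → E' i j ≡ E' j i
    E'⊆E     : ∀ i j → E' i j ≡ true → G i j ≡ true
    E'-ends  : ∀ i j → E' i j ≡ true → V' i ≡ true
    nonempty : ∃ λ i → V' i ≡ true
    conn     : ∀ u v → V' u ≡ true → V' v ≡ true → Walk E' u v

ConnSubSetoid : ∀ {n} → Graph n → Setoid 0ℓ 0ℓ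
ConnSubSetoid {n} G = record
  { Carrier = ConnSub G
  ; _≈_ = λ A B → (∀ i → ConnSub.V' A i ≡ ConnSub.V' B i)
                 × (∀ i j → ConnSub.E' A i j ≡ ConnSub.E' B i j)
  ; isEquivalence = record
    { refl  = (λ _ → refl) Data.Product., (λ _ _ → refl)
    ; sym   = λ (p Data.Product., q) → (λ i → sym (p i)) Data.Product., (λ i j → sym (q i j))
    ; trans = λ (p Data.Product., q) (p' Data.Product., q') →
                (λ i → trans (p i) (p' i)) Data.Product., (λ i j → trans (q i j) (q' i j))
    }
  }

-- F(G) = k : the number of connected subgraphs of G is k
-- (a bijection between Fin k and the connected subgraphs, up to equal (V', E')).
CoreIndexIs : ∀ {n} → Graph n → ℕ → Set
CoreIndexIs G k = Inverse (≡.setoid (Fin k)) (ConnSubSetoid G)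

{-# OPTIONS --safe #-}

-- Write n for the number of vertices. In a 2-connected graph any two distinct vertices are joined
-- by two different paths, and a path determines its pair of ends; with the n one-vertex paths and
-- the whole graph, which is not a path, this gives F(G) ≥ n² + 1. A vertex with three neighbours
-- contributes one more connected subgraph, a claw. Without such a vertex, an edge uv together with
-- a second path from u to v is a Hamiltonian cycle containing all edges, so G ≅ C_n. Finally
-- F(C_n) ≤ n² + 1, as a connected subgraph of C_n is C_n itself or an arc, given by its first
-- vertex and its length.
module Submission where

open import Defs
open import Data.Bool using (Bool; true; false; _∧_; T)
open import Data.Bool.Properties using (T-≡; T-∧; T-∨; ¬-not) renaming (_≟_ to _≟ᵇ_)
open import Data.Fin using (Fin; zero; suc; toℕ; fromℕ<; _≟_; punchIn; punchOut; combine; remQuot)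
open import Data.Fin.Permutation using (permutation; _⟨$⟩ʳ_; _⟨$⟩ˡ_) renaming (inverseˡ to permInverseˡ; inverseʳ to permInverseʳ)
open import Data.Fin.Properties using (any?; injective⇒≤; punchIn-punchOut; punchIn-injective; punchInᵢ≢i; toℕ<n; toℕ-injective; toℕ-fromℕ<; fromℕ<-injective; combine-injective; combine-remQuot; <-cmp) renaming (suc-injective to Fin-suc-injective)
open import Data.Nat using (ℕ; zero; suc; _+_; _*_; _∸_; _≤_; _<_; _≡ᵇ_; z≤n; s≤s; s≤s⁻¹)
open import Data.Nat.DivMod using (_%_; _mod_; m%n<n; m%n%n≡m%n; [m+n]%n≡m%n; m<n⇒m%n≡m; n%n≡0; %-distribˡ-+)
open import Data.Nat.Properties using (≤-refl; ≤-trans; ≤-antisym; ≤-reflexive; <⇒≤; <-irrefl; <-trans; n<1+n; n≤0⇒n≡0; m≤n⇒m<n∨m≡n; m+[n∸m]≡n; +-monoʳ-≤; +-cancelˡ-≡; +-suc; +-comm; +-assoc; +-identityʳ; suc-injective; anyUpTo?; ≡ᵇ⇒≡; ≡⇒≡ᵇ; n≢0⇒n>0)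
open import Data.Product using (Σ; ∃; _×_; _,_; proj₁; proj₂)
open import Data.Sum using (_⊎_; inj₁; inj₂; [_,_]; swap)
import Data.Sum as Sum
open import Function.Bundles using (_⇔_; mk⇔; Inverse; Equivalence)
open import Relation.Binary.Bundles using (Setoid)
open import Relation.Binary.Definitions using (tri<; tri≈; tri>)
open import Relation.Binary.PropositionalEquality using (_≡_; _≢_; refl; sym; trans; cong; cong₂; subst; subst₂; module ≡-Reasoning)
open import Relation.Nullary using (¬_; Dec; yes; no; does; contradiction)
open import Relation.Nullary.Decidable using (⌊_⌋; dec-true; ¬?; _×-dec_; _⊎-dec_)

open ConnSub

-- Equality of subgraphs and of truth values.

infix 4 _≈ₛ_

_≈ₛ_ : ∀ {n} {G : Graph n} → ConnSub G → ConnSub G → Set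
_≈ₛ_ {G = G} = Setoid._≈_ (ConnSubSetoid G)

≈ₛ-sym : ∀ {n} {G : Graph n} {A B : ConnSub G} → A ≈ₛ B → B ≈ₛ A
≈ₛ-sym {G = G} {A} {B} = Setoid.sym (ConnSubSetoid G) {A} {B}

true-dec : ∀ {A : Set} (a? : Dec A) → does a? ≡ true → A
true-dec (yes a) _ = a

bool-ext : ∀ {a b : Bool} → (a ≡ true → b ≡ true) → (b ≡ true → a ≡ true) → a ≡ b
bool-ext {true}  {_}     f _ = sym (f refl)
bool-ext {false} {false} _ _ = refl
bool-ext {false} {true}  _ g = g refl

-- Counting up to equality of subgraphs

coreIndex≥ : ∀ {n} {G : Graph n} {k N} → CoreIndexIs G k → (f : Fin N → ConnSub G) →
  (∀ x y → f x ≈ₛ f y → x ≡ y) → N ≤ k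
coreIndex≥ {G = G} I f f-inj = injective⇒≤ {f = λ x → from (f x)} λ {x} {y} eq →
  f-inj x y (Setoid.trans S {f x} {to (from (f x))} {f y}
    (≈ₛ-sym {A = to (from (f x))} {f x} (strictlyInverseˡ (f x)))
    (inverseˡ eq))
  where
  S = ConnSubSetoid G
  open Inverse I

-- Only the values of `g` on the representatives `to x` matter, so `g` may be any function on the
-- records; nothing is asked about how it treats equal subgraphs.
coreIndex≤ : ∀ {n} {G : Graph n} {k N} → CoreIndexIs G k → (g : ConnSub G → Fin N) →
  (∀ A B → g A ≡ g B → A ≈ₛ B) → k ≤ N
coreIndex≤ I g g-inj = injective⇒≤ {f = λ x → g (to x)} λ {x} {y} eq →
  trans (sym (strictlyInverseʳ x)) (inverseʳ (g-inj (to x) (to y) eq))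
  where open Inverse I

coreIndex-mono : ∀ {n} {G H : Graph n} {k m} → CoreIndexIs G k → CoreIndexIs H m →
  (φ : ConnSub G → ConnSub H) → (∀ A B → φ A ≈ₛ φ B → A ≈ₛ B) → k ≤ m
coreIndex-mono I J φ φ-inj = coreIndex≥ J (λ x → φ (to x)) λ x y eq →
  trans (sym (strictlyInverseʳ x)) (inverseʳ (φ-inj (to x) (to y) eq))
  where open Inverse I

-- Walks

module _ {n : ℕ} {P : Graph n} where

  _++ʷ_ : ∀ {u v w} → Walk P u v → Walk P v w → Walk P u w
  here     ++ʷ q = q
  step e p ++ʷ q = step e (p ++ʷ q)

  reverseʷ : (∀ i j → P i j ≡ P j i) → ∀ {u v} → Walk P u v → Walk P v u
  reverseʷ P-sym here = here
  reverseʷ P-sym (step e p) = reverseʷ P-sym p ++ʷ step (trans (P-sym _ _) e) here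

  -- Serves twice to exploit connectedness: to show that a cycle covers the whole graph, and that a
  -- connected subgraph stays inside an arc.
  walk-closed : (Q : Fin n → Set) → (∀ {x y} → Q x → P x y ≡ true → Q y) →
    ∀ {u v} → Walk P u v → Q u → Q v
  walk-closed Q closed here       q = q
  walk-closed Q closed (step e p) q = walk-closed Q closed p (closed q e)

mapʷ : ∀ {n} {P Q : Graph n} (f : Fin n → Fin n) → (∀ {i j} → P i j ≡ true → Q (f i) (f j) ≡ true) →
  ∀ {u v} → Walk P u v → Walk Q (f u) (f v)
mapʷ f h here       = here
mapʷ f h (step e p) = step (h e) (mapʷ f h p)

deleteVertex-true : ∀ {n} (G : Graph n) x {i j} → deleteVertex G x i j ≡ true →
  G i j ≡ true × x ≢ i × x ≢ j
deleteVertex-true G x {i} {j} e with G i j | x ≟ i | x ≟ j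
... | true  | no x≢i | no x≢j = refl , x≢i , x≢j

isYes-≢ : ∀ {n} {x y : Fin n} → x ≢ y → ⌊ x ≟ y ⌋ ≡ false
isYes-≢ {x = x} {y} x≢y with x ≟ y
... | yes x≡y = contradiction x≡y x≢y
... | no  _   = refl

-- Simple paths

-- `at` is total on `ℕ`, so tails and extensions of paths need no coercions between index types;
-- only its values up to `len` are constrained.
record Path {n : ℕ} (G : Graph n) (u v : Fin n) : Set where
  field
    len   : ℕ
    at    : ℕ → Fin n
    start : at 0 ≡ u
    end   : at len ≡ v
    inj   : ∀ {a b} → a ≤ len → b ≤ len → at a ≡ at b → a ≡ b
    adj   : ∀ {a} → a < len → G (at a) (at (suc a)) ≡ true

open Path

trivialPath : ∀ {n} {G : Graph n} u → Path G u u
trivialPath u = record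
  { len = 0 ; at = λ _ → u ; start = refl ; end = refl
  ; inj = λ a≤0 b≤0 _ → trans (n≤0⇒n≡0 a≤0) (sym (n≤0⇒n≡0 b≤0))
  ; adj = λ () }

dropPath : ∀ {n} {G : Graph n} {u v} (p : Path G u v) {e} → e ≤ len p → Path G (at p e) v
dropPath {G = G} p {e} e≤ = record
  { len = len p ∸ e ; at = λ a → at p (e + a)
  ; start = cong (at p) (+-identityʳ e)
  ; end = trans (cong (at p) (m+[n∸m]≡n e≤)) (end p)
  ; inj = λ a≤ b≤ eq → +-cancelˡ-≡ e _ _ (inj p (shift a≤) (shift b≤) eq)
  ; adj = λ {a} a< → subst (λ z → G (at p (e + a)) (at p z) ≡ true) (sym (+-suc e a))
      (adj p (≤-trans (≤-reflexive (sym (+-suc e a))) (shift a<))) }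
  where
  shift : ∀ {a} → a ≤ len p ∸ e → e + a ≤ len p
  shift a≤ = ≤-trans (+-monoʳ-≤ e a≤) (≤-reflexive (m+[n∸m]≡n e≤))

consPath : ∀ {n} {G : Graph n} {u w v} → G u w ≡ true → (p : Path G w v) →
  (∀ a → a ≤ len p → at p a ≢ u) → Path G u v
consPath {n} {G} {u} e p u∉p = record
  { len = suc (len p) ; at = at′ ; start = refl ; end = end p ; inj = inj′ ; adj = adj′ }
  where
  at′ : ℕ → Fin n
  at′ zero    = u
  at′ (suc a) = at p a
  inj′ : ∀ {a b} → a ≤ suc (len p) → b ≤ suc (len p) → at′ a ≡ at′ b → a ≡ b
  inj′ {zero}  {zero}  _ _ _ = refl
  inj′ {zero}  {suc b} _ (s≤s b≤) eq = contradiction (sym eq) (u∉p b b≤)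
  inj′ {suc a} {zero}  (s≤s a≤) _ eq = contradiction eq (u∉p a a≤)
  inj′ {suc a} {suc b} (s≤s a≤) (s≤s b≤) eq = cong suc (inj p a≤ b≤ eq)
  adj′ : ∀ {a} → a < suc (len p) → G (at′ a) (at′ (suc a)) ≡ true
  adj′ {zero}  _        = subst (λ z → G u z ≡ true) (sym (start p)) e
  adj′ {suc a} (s≤s a<) = adj p a<

-- Loop removal, by induction on the walk: if the new first vertex already lies on the path obtained
-- from the rest, the tail from that position is kept.
walk⇒path : ∀ {n} {G : Graph n} {u v} → Walk G u v → Path G u v
walk⇒path {u = u} here = trivialPath u
walk⇒path {u = u} (step e w) with walk⇒path w
... | p with anyUpTo? (λ a → at p a ≟ u) (suc (len p))
... | yes (a , a< , refl) = dropPath p (s≤s⁻¹ a<)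
... | no  u∉p = consPath e p λ a a≤ eq → u∉p (a , s≤s a≤ , eq)

mapPath : ∀ {n} {G H : Graph n} → (∀ {i j} → G i j ≡ true → H i j ≡ true) →
  ∀ {u v} → Path G u v → Path H u v
mapPath h p = record
  { len = len p ; at = at p ; start = start p ; end = end p ; inj = inj p ; adj = λ a< → h (adj p a<) }

len≢0 : ∀ {n} {G : Graph n} {u v} (p : Path G u v) → u ≢ v → len p ≢ 0
len≢0 p u≢v len≡0 = u≢v (trans (sym (start p)) (trans (cong (at p) (sym len≡0)) (end p)))

edgePath : ∀ {n} {G : Graph n} {u v} → u ≢ v → G u v ≡ true → Path G u v
edgePath {u = u} {v} u≢v e = consPath e (trivialPath v) λ _ _ v≡u → u≢v (sym v≡u)

-- The subgraph of a path

module _ {n : ℕ} {G : Graph n} where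

  OnPath : ∀ {u v} → Path G u v → Fin n → Set
  OnPath p x = ∃ λ a → a < suc (len p) × at p a ≡ x

  Link : (ℕ → Fin n) → Fin n → Fin n → ℕ → Set
  Link f x y a = (f a ≡ x × f (suc a) ≡ y) ⊎ (f a ≡ y × f (suc a) ≡ x)

  EdgeOfPath : ∀ {u v} → Path G u v → Fin n → Fin n → Set
  EdgeOfPath p x y = ∃ λ a → a < len p × Link (at p) x y a

  onPath? : ∀ {u v} (p : Path G u v) x → Dec (OnPath p x)
  onPath? p x = anyUpTo? (λ a → at p a ≟ x) (suc (len p))

  edgeOfPath? : ∀ {u v} (p : Path G u v) x y → Dec (EdgeOfPath p x y)
  edgeOfPath? p x y = anyUpTo?
    (λ a → (at p a ≟ x ×-dec at p (suc a) ≟ y) ⊎-dec (at p a ≟ y ×-dec at p (suc a) ≟ x)) (len p)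

  edgeOfPath-sym : ∀ {u v} (p : Path G u v) {x y} → EdgeOfPath p x y → EdgeOfPath p y x
  edgeOfPath-sym p (a , a< , l) = a , a< , swap l

  -- Since `at p` is injective, only the links in positions `a` and `a - 1` can touch the vertex in
  -- position `a`. Ends and degrees in path subgraphs are read off from this.
  pathNeighbour : ∀ {u v} (p : Path G u v) {a y} → a ≤ len p → EdgeOfPath p (at p a) y →
    (a < len p × y ≡ at p (suc a)) ⊎ ∃ λ b → a ≡ suc b × y ≡ at p b
  pathNeighbour p a≤ (b , b< , inj₁ (eq , refl)) with inj p (<⇒≤ b<) a≤ eq
  ... | refl = inj₁ (b< , refl)
  pathNeighbour p a≤ (b , b< , inj₂ (refl , eq)) = inj₂ (b , inj p a≤ b< (sym eq) , refl)

  path-start-neighbour : ∀ {u v} (p : Path G u v) {y} → EdgeOfPath p u y → y ≡ at p 1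
  path-start-neighbour p {y} e
    with pathNeighbour p z≤n (subst (λ z → EdgeOfPath p z y) (sym (start p)) e)
  ... | inj₁ (_ , eq) = eq

  path-end-neighbour : ∀ {u v} (p : Path G u v) {y} → EdgeOfPath p v y → ∃ λ b → suc b ≡ len p × y ≡ at p b
  path-end-neighbour p {y} e
    with pathNeighbour p ≤-refl (subst (λ z → EdgeOfPath p z y) (sym (end p)) e)
  ... | inj₁ (l<l , _) = contradiction l<l (<-irrefl refl)
  ... | inj₂ (b , eq , eq′) = b , sym eq , eq′

module _ {n : ℕ} {G : Graph n} (G-sym : ∀ i j → G i j ≡ G j i) where

  pathSub : ∀ {u v} → Path G u v → ConnSub G
  pathSub p = record
    { V'       = λ x → does (onPath? p x)
    ; E'       = E
    ; E'-sym   = E-sym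
    ; E'⊆E     = λ i j e → edge⊆ (true-dec (edgeOfPath? p i j) e)
    ; E'-ends  = λ i j e → dec-true (onPath? p i) (edge-onPath (true-dec (edgeOfPath? p i j) e))
    ; nonempty = at p 0 , dec-true (onPath? p (at p 0)) (0 , s≤s z≤n , refl)
    ; conn     = λ x y Vx Vy → connect (true-dec (onPath? p x) Vx) (true-dec (onPath? p y) Vy)
    }
    where
    E : Graph n
    E x y = does (edgeOfPath? p x y)
    E-sym : ∀ i j → E i j ≡ E j i
    E-sym i j = bool-ext
      (λ e → dec-true (edgeOfPath? p j i) (edgeOfPath-sym p (true-dec (edgeOfPath? p i j) e)))
      (λ e → dec-true (edgeOfPath? p i j) (edgeOfPath-sym p (true-dec (edgeOfPath? p j i) e)))
    edge⊆ : ∀ {i j} → EdgeOfPath p i j → G i j ≡ true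
    edge⊆ (a , a< , inj₁ (refl , refl)) = adj p a<
    edge⊆ (a , a< , inj₂ (refl , refl)) = trans (G-sym _ _) (adj p a<)
    edge-onPath : ∀ {i j} → EdgeOfPath p i j → OnPath p i
    edge-onPath (a , a< , inj₁ (eq , _)) = a , <-trans a< (n<1+n _) , eq
    edge-onPath (a , a< , inj₂ (_ , eq)) = suc a , s≤s a< , eq
    initial : ∀ a → a ≤ len p → Walk E (at p 0) (at p a)
    initial zero    _  = here
    initial (suc a) a< = initial a (<⇒≤ a<) ++ʷ
      step (dec-true (edgeOfPath? p _ _) (a , a< , inj₁ (refl , refl))) here
    connect : ∀ {x y} → OnPath p x → OnPath p y → Walk E x y
    connect (a , a< , refl) (b , b< , refl) =
      reverseʷ E-sym (initial a (s≤s⁻¹ a<)) ++ʷ initial b (s≤s⁻¹ b<)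

-- Ends of a connected subgraph: vertices of degree at most one.

IsEnd : ∀ {n} {G : Graph n} → ConnSub G → Fin n → Set
IsEnd A x = V' A x ≡ true × (∀ y z → E' A x y ≡ true → E' A x z ≡ true → y ≡ z)

IsEnd-resp : ∀ {n} {G : Graph n} {A B : ConnSub G} → A ≈ₛ B → ∀ {x} → IsEnd A x → IsEnd B x
IsEnd-resp (V≡ , E≡) {x} (Vx , unique) = trans (sym (V≡ x)) Vx ,
  λ y z e f → unique y z (trans (E≡ x y) e) (trans (E≡ x z) f)

module _ {n : ℕ} {G : Graph n} (G-sym : ∀ i j → G i j ≡ G j i) where

  start-IsEnd : ∀ {u v} (p : Path G u v) → IsEnd (pathSub G-sym p) u
  start-IsEnd p = dec-true (onPath? p _) (0 , s≤s z≤n , start p) , λ y z e f →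
    trans (path-start-neighbour p (true-dec (edgeOfPath? p _ y) e))
      (sym (path-start-neighbour p (true-dec (edgeOfPath? p _ z) f)))

  end-IsEnd : ∀ {u v} (p : Path G u v) → IsEnd (pathSub G-sym p) v
  end-IsEnd p = dec-true (onPath? p _) (len p , n<1+n _ , end p) , unique
    where
    unique : ∀ y z → _ → _ → y ≡ z
    unique y z e f with path-end-neighbour p (true-dec (edgeOfPath? p _ y) e)
                      | path-end-neighbour p (true-dec (edgeOfPath? p _ z) f)
    ... | b , eq , refl | c , eq′ , refl = cong (at p) (suc-injective (trans eq (sym eq′)))

  -- An inner vertex has two different neighbours on the path, its predecessor and its successor.
  IsEnd⇒start⊎end : ∀ {u v} (p : Path G u v) {x} → IsEnd (pathSub G-sym p) x → x ≡ u ⊎ x ≡ v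
  IsEnd⇒start⊎end p {x} (Vx , unique) with true-dec (onPath? p x) Vx
  ... | zero , _ , refl = inj₁ (start p)
  ... | suc a , s≤s a< , refl with m≤n⇒m<n∨m≡n a<
  ... | inj₂ eq = inj₂ (trans (cong (at p) eq) (end p))
  ... | inj₁ sa< = contradiction (inj p (<⇒≤ a<) sa< (unique (at p a) (at p (suc (suc a)))
          (dec-true (edgeOfPath? p _ _) (a , a< , inj₂ (refl , refl)))
          (dec-true (edgeOfPath? p _ _) (suc a , sa< , inj₁ (refl , refl)))))
        λ ()

  -- Ends are invariant under `≈ₛ`, so each end of one path is an end of the other.
  pathSub-ends : ∀ {u v u′ v′} (p : Path G u v) (q : Path G u′ v′) → pathSub G-sym p ≈ₛ pathSub G-sym q →
    (u ≡ u′ × v ≡ v′) ⊎ (u ≡ v′ × v ≡ u′)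
  pathSub-ends p q p≈q
    with IsEnd⇒start⊎end q (IsEnd-resp {A = pathSub G-sym p} {pathSub G-sym q} p≈q (start-IsEnd p))
       | IsEnd⇒start⊎end q (IsEnd-resp {A = pathSub G-sym p} {pathSub G-sym q} p≈q (end-IsEnd p))
       | IsEnd⇒start⊎end p (IsEnd-resp {A = pathSub G-sym q} {pathSub G-sym p} q≈p (start-IsEnd q))
       | IsEnd⇒start⊎end p (IsEnd-resp {A = pathSub G-sym q} {pathSub G-sym p} q≈p (end-IsEnd q))
    where q≈p = ≈ₛ-sym {A = pathSub G-sym p} {pathSub G-sym q} p≈q
  ... | inj₁ refl | inj₂ refl | _         | _         = inj₁ (refl , refl)
  ... | inj₂ refl | inj₁ refl | _         | _         = inj₂ (refl , refl)
  -- Here both ends of `p` are the same end of `q`; the other end of `q` is an end of `p` too, so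
  -- all four vertices coincide.
  ... | inj₁ refl | inj₁ refl | _         | inj₁ refl = inj₁ (refl , refl)
  ... | inj₁ refl | inj₁ refl | _         | inj₂ refl = inj₁ (refl , refl)
  ... | inj₂ refl | inj₂ refl | inj₁ refl | _         = inj₁ (refl , refl)
  ... | inj₂ refl | inj₂ refl | inj₂ refl | _         = inj₁ (refl , refl)

  -- Pigeonhole: each of the three vertices is the predecessor or the successor of `x` on the path.
  -- This separates paths from claws.
  path-degree≤2 : ∀ {u v} (p : Path G u v) {x y₁ y₂ y₃} →
    let E = E' (pathSub G-sym p) in E x y₁ ≡ true → E x y₂ ≡ true → E x y₃ ≡ true →
    y₁ ≡ y₂ ⊎ y₁ ≡ y₃ ⊎ y₂ ≡ y₃
  path-degree≤2 p {x} {y₁} {y₂} {y₃} e₁ e₂ e₃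
    with true-dec (onPath? p x) (E'-ends (pathSub G-sym p) x y₁ e₁)
  ... | a , a< , refl with pathNeighbour p (s≤s⁻¹ a<) (true-dec (edgeOfPath? p x y₁) e₁)
                         | pathNeighbour p (s≤s⁻¹ a<) (true-dec (edgeOfPath? p x y₂) e₂)
                         | pathNeighbour p (s≤s⁻¹ a<) (true-dec (edgeOfPath? p x y₃) e₃)
  ... | inj₁ (_ , refl)        | inj₁ (_ , refl)        | _ = inj₁ refl
  ... | inj₁ (_ , refl)        | inj₂ _                 | inj₁ (_ , refl) = inj₂ (inj₁ refl)
  ... | inj₁ _                 | inj₂ (_ , refl , refl) | inj₂ (_ , refl , refl) = inj₂ (inj₂ refl)
  ... | inj₂ (_ , refl , refl) | inj₂ (_ , refl , refl) | _ = inj₁ refl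
  ... | inj₂ (_ , refl , refl) | inj₁ _                 | inj₂ (_ , refl , refl) = inj₂ (inj₁ refl)
  ... | inj₂ _                 | inj₁ (_ , refl)        | inj₁ (_ , refl) = inj₂ (inj₂ refl)

-- 2-connected graphs

thirdVertex : ∀ {n} → 3 ≤ n → {u v : Fin n} → u ≢ v → ∃ λ x → x ≢ u × x ≢ v
thirdVertex (s≤s (s≤s (s≤s z≤n))) {u} {v} u≢v =
  -- `v′` is the index of `v` among the vertices other than `u`; skipping `v′` and then `u` leaves a
  -- vertex different from both.
  punchIn u (punchIn v′ zero) , punchInᵢ≢i u _ , λ eq →
    punchInᵢ≢i v′ zero (punchIn-injective u _ _ (trans eq (sym (punchIn-punchOut u≢v))))
  where v′ = punchOut u≢v

otherVertex : ∀ {n} → 3 ≤ n → (u : Fin n) → ∃ λ v → u ≢ v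
otherVertex (s≤s (s≤s _)) u = punchIn u zero , λ eq → punchInᵢ≢i u zero (sym eq)

module TwoConnectedGraph {n : ℕ} {G : Graph n} (simple : IsSimple G) (twoConn : TwoConnected G) where

  private
    G-sym = proj₁ simple
    3≤n   = proj₁ twoConn
    conG  = proj₁ (proj₂ twoConn)

    sub : ∀ {u v} → Path G u v → ConnSub G
    sub = pathSub G-sym

  avoiding : ∀ x {u v} → x ≢ u → x ≢ v → Walk (deleteVertex G x) u v
  avoiding x x≢u x≢v = proj₂ (proj₂ twoConn) x _ _ (isYes-≢ x≢u) (isYes-≢ x≢v)

  edge⇒≢ : ∀ {u v} → G u v ≡ true → u ≢ v
  edge⇒≢ {u} e refl = contradiction (trans (sym e) (proj₂ simple u)) λ ()

  -- Through a third vertex x: the walk from u to x avoids v and the walk from x to v avoids u,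
  -- so neither contains a step from u to v.
  detour : ∀ {u v} → u ≢ v → Σ (Path G u v) λ p → len p ≢ 1
  detour {u} {v} u≢v with thirdVertex 3≤n u≢v
  ... | x , x≢u , x≢v = mapPath (λ {i} {j} e → proj₁ (true-dec (keep? i j) e)) p , len≢1
    where
    -- Only the direction from `u` to `v` is removed, so `G⁻` need not be symmetric; a path of
    -- length 1 from `u` to `v` would use exactly this direction.
    keep? : ∀ i j → Dec (G i j ≡ true × ¬ (i ≡ u × j ≡ v))
    keep? i j = (G i j ≟ᵇ true) ×-dec ¬? (i ≟ u ×-dec j ≟ v)
    G⁻ : Graph n
    G⁻ i j = does (keep? i j)
    u↝x : Walk G⁻ u x
    u↝x = mapʷ (λ i → i) (λ {i} {j} e → let (g , _ , v≢j) = deleteVertex-true G v e in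
      dec-true (keep? i j) (g , λ (_ , j≡v) → v≢j (sym j≡v)))
      (avoiding v (λ eq → u≢v (sym eq)) (λ eq → x≢v (sym eq)))
    x↝v : Walk G⁻ x v
    x↝v = mapʷ (λ i → i) (λ {i} {j} e → let (g , u≢i , _) = deleteVertex-true G u e in
      dec-true (keep? i j) (g , λ (i≡u , _) → u≢i (sym i≡u)))
      (avoiding u (λ eq → x≢u (sym eq)) u≢v)
    p : Path G⁻ u v
    p = walk⇒path (u↝x ++ʷ x↝v)
    len≢1 : len p ≢ 1
    len≢1 len≡1 = proj₂ (true-dec (keep? _ _) (adj p {0} (≤-reflexive (sym len≡1))))
      (start p , trans (cong (at p) (sym len≡1)) (end p))

  neighbour : ∀ u → ∃ λ v → G u v ≡ true
  neighbour u with otherVertex 3≤n u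
  ... | v , u≢v with walk⇒path (conG u v)
  ... | p = at p 1 , subst (λ z → G z (at p 1) ≡ true) (start p) (adj p (n≢0⇒n>0 (len≢0 p u≢v)))

  -- A detour from `u` to `v` leaves `u` through a vertex other than `v`, because a path that is at
  -- `v` in position 1 has length 1.
  otherNeighbour : ∀ {u v} → G u v ≡ true → ∃ λ y → G u y ≡ true × y ≢ v
  otherNeighbour {u} {v} e with detour (edge⇒≢ e)
  ... | p , len≢1 = at p 1 , subst (λ z → G z (at p 1) ≡ true) (start p) (adj p 0<len) , λ eq →
      len≢1 (sym (inj p 0<len ≤-refl (trans eq (sym (end p)))))
    where 0<len = n≢0⇒n>0 (len≢0 p (edge⇒≢ e))

  whole : ConnSub G
  whole = record
    { V' = λ _ → true ; E' = G ; E'-sym = G-sym ; E'⊆E = λ _ _ e → e ; E'-ends = λ _ _ _ → refl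
    ; nonempty = fromℕ< (≤-trans (s≤s z≤n) 3≤n) , refl ; conn = λ u v _ _ → conG u v }

  -- All degrees are at least two. This tells `whole` from every path and from every claw, since
  -- these have ends.
  whole-endless : ∀ {x} → ¬ IsEnd whole x
  whole-endless {x} (_ , unique) with neighbour x
  ... | v , e with otherNeighbour e
  ... | y , e′ , y≢v = y≢v (unique y v e′ e)

  path≉whole : ∀ {u v} (p : Path G u v) → ¬ sub p ≈ₛ whole
  path≉whole p p≈w = whole-endless (IsEnd-resp {A = sub p} {whole} p≈w (start-IsEnd G-sym p))

  -- For adjacent vertices the edge and a detour differ. Otherwise a path has an inner vertex, and
  -- 2-connectedness gives a second path avoiding it. The second path runs from `v` to `u` as it
  -- will represent the pair `(v, u)`.
  twoPaths : ∀ u v → Σ (Path G u v) λ p → Σ (Path G v u) λ q → (u ≢ v → ¬ sub p ≈ₛ sub q)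
  twoPaths u v with u ≟ v
  ... | yes refl = trivialPath u , trivialPath u , λ u≢u → contradiction refl u≢u
  ... | no u≢v with G u v ≟ᵇ true
  -- If the subgraphs were equal, `q` would contain the edge `vu`, hence start with it and have
  -- length 1.
  ... | yes e = p , q , λ _ (_ , E≡) → len≢1 (sym (inj q 0<len ≤-refl
          (trans (sym (path-start-neighbour q (true-dec (edgeOfPath? q v u)
              (trans (sym (E≡ v u)) (dec-true (edgeOfPath? p v u) (0 , s≤s z≤n , inj₂ (refl , refl)))))))
            (sym (end q)))))
    where
    v≢u : v ≢ u
    v≢u eq = u≢v (sym eq)
    p = edgePath {G = G} u≢v e
    q = proj₁ (detour v≢u)
    len≢1 = proj₂ (detour v≢u)
    0<len = n≢0⇒n>0 (len≢0 q v≢u)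
  ... | no ¬e = p , mapPath (λ e → proj₁ (deleteVertex-true G x e)) q , λ _ (V≡ , _) →
          x∉q (true-dec (onPath? q x) (trans (sym (V≡ x)) (dec-true (onPath? p x) (1 , s≤s 0<len , refl))))
    where
    p = walk⇒path (conG u v)
    0<len = n≢0⇒n>0 (len≢0 p u≢v)
    x = at p 1
    x≢u : x ≢ u
    x≢u eq = contradiction (inj p 0<len z≤n (trans eq (sym (start p)))) λ ()
    x≢v : x ≢ v
    x≢v eq = ¬e (subst₂ (λ y z → G y z ≡ true) (start p) eq (adj p 0<len))
    q : Path (deleteVertex G x) v u
    q = walk⇒path (avoiding x x≢v x≢u)
    x∉q : ¬ OnPath q x
    -- Every position of `q` before the last is the starting point of an edge of `deleteVertex G x`,
    -- and the last vertex is `u`.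
    x∉q (a , a< , eq) with m≤n⇒m<n∨m≡n (s≤s⁻¹ a<)
    ... | inj₁ a<len = proj₁ (proj₂ (deleteVertex-true G x (adj q a<len))) (sym eq)
    ... | inj₂ refl  = x≢u (trans (sym eq) (end q))

  -- Comparing `u` with `v` makes the pairs `(u, v)` and `(v, u)` take the two members of one and
  -- the same `twoPaths`, hence different subgraphs.
  pairPath : ∀ u v → Path G u v
  pairPath u v with <-cmp u v
  ... | tri< _ _ _    = proj₁ (twoPaths u v)
  ... | tri≈ _ refl _ = trivialPath u
  ... | tri> _ _ _    = proj₁ (proj₂ (twoPaths v u))

  pairPath-swap : ∀ u v → sub (pairPath u v) ≈ₛ sub (pairPath v u) → u ≡ v
  pairPath-swap u v p≈q with <-cmp u v | <-cmp v u
  ... | tri≈ _ u≡v _  | _             = u≡v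
  ... | tri< _ _ _    | tri≈ _ v≡u _  = sym v≡u
  ... | tri> _ _ _    | tri≈ _ v≡u _  = sym v≡u
  ... | tri< _ _ v≮u  | tri< v<u _ _  = contradiction v<u v≮u
  ... | tri> _ _ v<u  | tri> v≮u _ _  = contradiction v<u v≮u
  ... | tri< _ u≢v _  | tri> _ _ _    = contradiction p≈q (proj₂ (proj₂ (twoPaths u v)) u≢v)
  ... | tri> _ u≢v _  | tri< _ _ _    = contradiction
          (≈ₛ-sym {A = sub (proj₁ (proj₂ (twoPaths v u)))} {sub (proj₁ (twoPaths v u))} p≈q)
          (proj₂ (proj₂ (twoPaths v u)) (λ eq → u≢v (sym eq)))

  indexedPath : (x : Fin (n * n)) → Path G (proj₁ (remQuot {n} n x)) (proj₂ (remQuot {n} n x))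
  indexedPath x = pairPath (proj₁ (remQuot {n} n x)) (proj₂ (remQuot {n} n x))

  pairSub : Fin (n * n) → ConnSub G
  pairSub x = sub (indexedPath x)

  -- The ends determine the unordered pair; if the pairs are reversed copies of each other,
  -- `pairPath-swap` puts them on the diagonal.
  pairSub-injective : ∀ x y → pairSub x ≈ₛ pairSub y → x ≡ y
  pairSub-injective x y eq = trans (sym (combine-remQuot {n} n x))
    (trans (same (remQuot {n} n x) (remQuot {n} n y) eq) (combine-remQuot {n} n y))
    where
    -- Stated for arbitrary pairs, so that the components are variables and the equations between
    -- ends can be matched with `refl`.
    same : (s t : Fin n × Fin n) →
      sub (pairPath (proj₁ s) (proj₂ s)) ≈ₛ sub (pairPath (proj₁ t) (proj₂ t)) →
      combine (proj₁ s) (proj₂ s) ≡ combine (proj₁ t) (proj₂ t)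
    same (u , v) (u′ , v′) p≈q with pathSub-ends G-sym (pairPath u v) (pairPath u′ v′) p≈q
    ... | inj₁ (refl , refl) = refl
    ... | inj₂ (refl , refl) with pairPath-swap u v p≈q
    ... | refl = refl

  pathsAndWhole : Fin (suc (n * n)) → ConnSub G
  pathsAndWhole zero    = whole
  pathsAndWhole (suc x) = pairSub x

  pathsAndWhole-injective : ∀ x y → pathsAndWhole x ≈ₛ pathsAndWhole y → x ≡ y
  pathsAndWhole-injective zero    zero    _  = refl
  pathsAndWhole-injective zero    (suc y) eq =
    contradiction (≈ₛ-sym {A = whole} {pairSub y} eq) (path≉whole (indexedPath y))
  pathsAndWhole-injective (suc x) zero    eq = contradiction eq (path≉whole (indexedPath x))
  pathsAndWhole-injective (suc x) (suc y) eq = cong suc (pairSub-injective x y eq)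

  -- Claws, the extra subgraphs at vertices with three neighbours.

  Claw : Fin n → Fin n → Fin n → Fin n → Set
  Claw c a b d = (G c a ≡ true × G c b ≡ true × G c d ≡ true) × a ≢ b × a ≢ d × b ≢ d

  module _ {c a b d : Fin n} (cl : Claw c a b d) where

    private
      Leaf : Fin n → Set
      Leaf x = x ≡ a ⊎ x ≡ b ⊎ x ≡ d

      leaf? : ∀ x → Dec (Leaf x)
      leaf? x = x ≟ a ⊎-dec x ≟ b ⊎-dec x ≟ d

      edge? : ∀ x y → Dec ((x ≡ c × Leaf y) ⊎ (y ≡ c × Leaf x))
      edge? x y = (x ≟ c ×-dec leaf? y) ⊎-dec (y ≟ c ×-dec leaf? x)

      vertex? : ∀ x → Dec (x ≡ c ⊎ Leaf x)
      vertex? x = x ≟ c ⊎-dec leaf? x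

      E : Graph n
      E x y = does (edge? x y)

      E-sym : ∀ x y → E x y ≡ E y x
      E-sym x y = bool-ext (λ e → dec-true (edge? y x) (swap (true-dec (edge? x y) e)))
                           (λ e → dec-true (edge? x y) (swap (true-dec (edge? y x) e)))

      leafEdge : ∀ {x} → Leaf x → G c x ≡ true
      leafEdge (inj₁ refl)        = proj₁ (proj₁ cl)
      leafEdge (inj₂ (inj₁ refl)) = proj₁ (proj₂ (proj₁ cl))
      leafEdge (inj₂ (inj₂ refl)) = proj₂ (proj₂ (proj₁ cl))

      fromCentre : ∀ {x} → x ≡ c ⊎ Leaf x → Walk E c x
      fromCentre (inj₁ refl) = here
      fromCentre (inj₂ l)    = step (dec-true (edge? c _) (inj₁ (refl , l))) here

    claw : ConnSub G
    claw = record
      { V' = λ x → does (vertex? x) ; E' = E ; E'-sym = E-sym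
      ; E'⊆E = λ i j e → [ (λ { (refl , l) → leafEdge l })
                         , (λ { (refl , l) → trans (G-sym _ _) (leafEdge l) }) ] (true-dec (edge? i j) e)
      ; E'-ends = λ i j e → dec-true (vertex? i) (Sum.map proj₁ proj₂ (true-dec (edge? i j) e))
      ; nonempty = c , dec-true (vertex? c) (inj₁ refl)
      ; conn = λ x y Vx Vy → reverseʷ E-sym (fromCentre (true-dec (vertex? x) Vx))
                               ++ʷ fromCentre (true-dec (vertex? y) Vy) }

    -- The leaf `a` has only the centre as a neighbour in the claw, while `whole` has no ends.
    claw≉whole : ¬ claw ≈ₛ whole
    claw≉whole eq = whole-endless {a} (IsEnd-resp {A = claw} {whole} eq
      (dec-true (vertex? a) (inj₂ (inj₁ refl)) , λ y z e f → trans (centre e) (sym (centre f))))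
      where
      centre : ∀ {y} → E a y ≡ true → y ≡ c
      centre {y} e with true-dec (edge? a y) e
      ... | inj₁ (a≡c , _) = contradiction (sym a≡c) (edge⇒≢ (proj₁ (proj₁ cl)))
      ... | inj₂ (y≡c , _) = y≡c

    claw≉path : ∀ {u v} (p : Path G u v) → ¬ claw ≈ₛ sub p
    claw≉path p (_ , E≡)
      with path-degree≤2 G-sym p {c} {a} {b} {d}
             (trans (sym (E≡ c a)) (dec-true (edge? c a) (inj₁ (refl , inj₁ refl))))
             (trans (sym (E≡ c b)) (dec-true (edge? c b) (inj₁ (refl , inj₂ (inj₁ refl)))))
             (trans (sym (E≡ c d)) (dec-true (edge? c d) (inj₁ (refl , inj₂ (inj₂ refl)))))
         | proj₂ cl
    ... | inj₁ a≡b        | a≢b , _ , _ = a≢b a≡b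
    ... | inj₂ (inj₁ a≡d) | _ , a≢d , _ = a≢d a≡d
    ... | inj₂ (inj₂ b≡d) | _ , _ , b≢d = b≢d b≡d

    clawPathsAndWhole : Fin (suc (suc (n * n))) → ConnSub G
    clawPathsAndWhole zero    = claw
    clawPathsAndWhole (suc x) = pathsAndWhole x

    claw≉pathsAndWhole : ∀ x → ¬ claw ≈ₛ pathsAndWhole x
    claw≉pathsAndWhole zero    = claw≉whole
    claw≉pathsAndWhole (suc x) = claw≉path (indexedPath x)

    clawPathsAndWhole-injective : ∀ x y → clawPathsAndWhole x ≈ₛ clawPathsAndWhole y → x ≡ y
    clawPathsAndWhole-injective zero    zero    _  = refl
    clawPathsAndWhole-injective zero    (suc y) eq = contradiction eq (claw≉pathsAndWhole y)
    clawPathsAndWhole-injective (suc x) zero    eq =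
      contradiction (≈ₛ-sym {A = pathsAndWhole x} {claw} eq) (claw≉pathsAndWhole x)
    clawPathsAndWhole-injective (suc x) (suc y) eq = cong suc (pathsAndWhole-injective x y eq)

  claw? : Dec (∃ λ c → ∃ λ a → ∃ λ b → ∃ λ d → Claw c a b d)
  claw? = any? λ c → any? λ a → any? λ b → any? λ d →
    (G c a ≟ᵇ true ×-dec G c b ≟ᵇ true ×-dec G c d ≟ᵇ true)
      ×-dec ¬? (a ≟ b) ×-dec ¬? (a ≟ d) ×-dec ¬? (b ≟ d)

-- Cyclic adjacency

-- Here `l` is the last index. The alternatives follow the order of the disjunction in `cycle`, so
-- that `cycle⇔` translates them one by one.
CycAdj : ℕ → ℕ → ℕ → Set
CycAdj l a b = suc a ≡ b ⊎ suc b ≡ a ⊎ (a ≡ 0 × b ≡ l) ⊎ (b ≡ 0 × a ≡ l)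

cycle⇔ : ∀ {n} {i j : Fin n} → cycle n i j ≡ true ⇔ CycAdj (n ∸ 1) (toℕ i) (toℕ j)
cycle⇔ {n} {i} {j} = mk⇔
  (λ e → Sum.map (≡ᵇ⇒≡ _ _) (λ e → Sum.map (≡ᵇ⇒≡ _ _) (λ e → Sum.map both⇒ both⇒
    (to T-∨ e)) (to T-∨ e)) (to T-∨ (from T-≡ e)))
  (λ e → to T-≡ (from T-∨ (Sum.map (≡⇒≡ᵇ _ _) (λ e → from T-∨ (Sum.map (≡⇒≡ᵇ _ _) (λ e → from T-∨
    (Sum.map both⇐ both⇐ e)) e)) e)))
  where
  open Equivalence
  both⇒ : ∀ {a b c d} → T ((a ≡ᵇ b) ∧ (c ≡ᵇ d)) → a ≡ b × c ≡ d
  both⇒ {a} {b} {c} {d} e = let (p , q) = to T-∧ e in ≡ᵇ⇒≡ a b p , ≡ᵇ⇒≡ c d q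
  both⇐ : ∀ {a b c d} → a ≡ b × c ≡ d → T ((a ≡ᵇ b) ∧ (c ≡ᵇ d))
  both⇐ {a} {b} {c} {d} (p , q) = from T-∧ (≡⇒≡ᵇ a b p , ≡⇒≡ᵇ c d q)

-- Maximum degree two

-- The path `p` and the edge `uw` close up to a cycle. Each of its vertices has two neighbours on it
-- already, so no edge leaves the cycle and no chord exists.
module Hamiltonian {n : ℕ} {G : Graph n} (simple : IsSimple G) (twoConn : TwoConnected G)
  (degree≤2 : ∀ {c a b d} → G c a ≡ true → G c b ≡ true → G c d ≡ true → a ≢ b → d ≡ a ⊎ d ≡ b)
  {u w : Fin n} (uw : G u w ≡ true) (p : Path G u w) (len≢1 : len p ≢ 1) where

  open TwoConnectedGraph simple twoConn

  private
    L = len p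
    G-sym = proj₁ simple

    0<L : 0 < L
    0<L = n≢0⇒n>0 (len≢0 p (edge⇒≢ uw))

    ends : G (at p 0) (at p L) ≡ true
    ends = subst₂ (λ x y → G x y ≡ true) (sym (start p)) (sym (end p)) uw

    flip : ∀ {x y} → G x y ≡ true → G y x ≡ true
    flip e = trans (G-sym _ _) e

    distinct : ∀ {a b} → a ≤ L → b ≤ L → a ≢ b → at p a ≢ at p b
    distinct a≤ b≤ a≢b eq = a≢b (inj p a≤ b≤ eq)

  neighbourOnCycle : ∀ {a y} → a ≤ L → G (at p a) y ≡ true →
    ∃ λ b → b ≤ L × at p b ≡ y × CycAdj L a b
  neighbourOnCycle {zero} a≤ e
    -- Position 0 has its neighbours in positions 1 and `L`, which differ because `p` is not a
    -- single edge.
    with degree≤2 (adj p 0<L) ends e (distinct 0<L ≤-refl (λ eq → len≢1 (sym eq)))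
  ... | inj₁ refl = 1 , 0<L , refl , inj₁ refl
  ... | inj₂ refl = L , ≤-refl , refl , inj₂ (inj₂ (inj₁ (refl , refl)))
  neighbourOnCycle {suc a} a< e with m≤n⇒m<n∨m≡n a<
  ... | inj₁ sa<
      with degree≤2 (flip (adj p a<)) (adj p sa<) e (distinct (<⇒≤ a<) sa< λ ())
  ...   | inj₁ refl = a , <⇒≤ a< , refl , inj₂ (inj₁ refl)
  ...   | inj₂ refl = suc (suc a) , sa< , refl , inj₁ refl
  neighbourOnCycle {suc a} a< e | inj₂ sa≡L
      with degree≤2 (flip (adj p a<)) (subst (λ z → G (at p z) (at p 0) ≡ true) (sym sa≡L) (flip ends)) e
             -- The neighbours of the last vertex are in positions `L - 1` and 0; if these were
             -- equal, `L` would be 1.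
             (distinct (<⇒≤ a<) z≤n (λ { refl → len≢1 (sym sa≡L) }))
  ...   | inj₁ refl = a , <⇒≤ a< , refl , inj₂ (inj₁ refl)
  ...   | inj₂ refl = 0 , z≤n , refl , inj₂ (inj₂ (inj₂ (refl , sa≡L)))

  cycAdj⇒edge : ∀ {a b} → a ≤ L → b ≤ L → CycAdj L a b → G (at p a) (at p b) ≡ true
  cycAdj⇒edge a≤ b≤ (inj₁ refl)                        = adj p b≤
  cycAdj⇒edge a≤ b≤ (inj₂ (inj₁ refl))                 = flip (adj p a≤)
  cycAdj⇒edge a≤ b≤ (inj₂ (inj₂ (inj₁ (refl , refl)))) = ends
  cycAdj⇒edge a≤ b≤ (inj₂ (inj₂ (inj₂ (refl , refl)))) = flip ends

  -- The vertices of the cycle are closed under taking neighbours, and `G` is connected.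
  covers : ∀ x → ∃ λ a → a ≤ L × at p a ≡ x
  covers x = walk-closed (λ x → ∃ λ a → a ≤ L × at p a ≡ x)
    (λ { (a , a≤ , refl) e → let (b , b≤ , eq , _) = neighbourOnCycle a≤ e in b , b≤ , eq })
    (proj₁ (proj₂ twoConn) u x) (0 , z≤n , start p)

  private
    pos : Fin n → ℕ
    pos x = proj₁ (covers x)

    pos≤ : ∀ x → pos x ≤ L
    pos≤ x = proj₁ (proj₂ (covers x))

    at-pos : ∀ x → at p (pos x) ≡ x
    at-pos x = proj₂ (proj₂ (covers x))

    pos-at : ∀ {a} → a ≤ L → pos (at p a) ≡ a
    pos-at {a} a≤ = inj p (pos≤ (at p a)) a≤ (at-pos (at p a))

    n≡1+L : n ≡ suc L
    n≡1+L = ≤-antisym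
      (injective⇒≤ {f = λ x → fromℕ< (s≤s (pos≤ x))} λ {x} {y} eq →
        trans (sym (at-pos x)) (trans
          (cong (at p) (fromℕ<-injective _ _ (s≤s (pos≤ x)) (s≤s (pos≤ y)) eq)) (at-pos y)))
      (injective⇒≤ {f = λ (i : Fin (suc L)) → at p (toℕ i)} λ {x} {y} eq →
        toℕ-injective (inj p (s≤s⁻¹ (toℕ<n x)) (s≤s⁻¹ (toℕ<n y)) eq))

    pos< : ∀ x → pos x < n
    pos< x = ≤-trans (s≤s (pos≤ x)) (≤-reflexive (sym n≡1+L))

    toℕ≤ : ∀ (i : Fin n) → toℕ i ≤ L
    toℕ≤ i = s≤s⁻¹ (≤-trans (toℕ<n i) (≤-reflexive n≡1+L))

    L≡n∸1 : L ≡ n ∸ 1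
    L≡n∸1 = cong (_∸ 1) (sym n≡1+L)

  ≅cycle : G ≅ cycle n
  ≅cycle = σ , λ i j → bool-ext (edge⇒ i j) (edge⇐ i j)
    where
    f : Fin n → Fin n
    f x = fromℕ< (pos< x)
    σ = permutation f (λ i → at p (toℕ i))
      (λ i → toℕ-injective (trans (toℕ-fromℕ< (pos< _)) (pos-at (toℕ≤ i))))
      (λ x → trans (cong (at p) (toℕ-fromℕ< (pos< x))) (at-pos x))
    Adj : ℕ → ℕ → Set
    Adj = CycAdj (n ∸ 1)
    edge⇒ : ∀ i j → G i j ≡ true → cycle n (f i) (f j) ≡ true
    edge⇒ i j e with neighbourOnCycle (pos≤ i) (subst (λ z → G z j ≡ true) (sym (at-pos i)) e)
    ... | b , b≤ , refl , c = Equivalence.from cycle⇔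
      (subst₂ Adj (sym (toℕ-fromℕ< (pos< i))) (trans (sym (pos-at b≤)) (sym (toℕ-fromℕ< (pos< j))))
        (subst (λ l → CycAdj l (pos i) b) L≡n∸1 c))
    edge⇐ : ∀ i j → cycle n (f i) (f j) ≡ true → G i j ≡ true
    edge⇐ i j e = subst₂ (λ x y → G x y ≡ true) (at-pos i) (at-pos j)
      (cycAdj⇒edge (pos≤ i) (pos≤ j) (subst (λ l → CycAdj l (pos i) (pos j)) (sym L≡n∸1)
        (subst₂ Adj (toℕ-fromℕ< (pos< i)) (toℕ-fromℕ< (pos< j)) (Equivalence.to cycle⇔ e))))

-- Any edge, with a detour between its ends, supplies the cycle; a third neighbour of a vertex would
-- form a claw.
clawFree⇒≅cycle : ∀ {n} {G : Graph n} (simple : IsSimple G) (twoConn : TwoConnected G) →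
  ¬ (∃ λ c → ∃ λ a → ∃ λ b → ∃ λ d → TwoConnectedGraph.Claw simple twoConn c a b d) → G ≅ cycle n
clawFree⇒≅cycle {G = G} simple twoConn ¬claw =
  let (w , uw)      = neighbour (fromℕ< (≤-trans (s≤s z≤n) (proj₁ twoConn)))
      (p , len≢1)   = detour (edge⇒≢ uw)
  in Hamiltonian.≅cycle simple twoConn degree≤2 uw p len≢1
  where
  open TwoConnectedGraph simple twoConn
  degree≤2 : ∀ {c a b d} → G c a ≡ true → G c b ≡ true → G c d ≡ true → a ≢ b → d ≡ a ⊎ d ≡ b
  degree≤2 {c} {a} {b} {d} ca cb cd a≢b with d ≟ a | d ≟ b
  ... | yes d≡a | _       = inj₁ d≡a
  ... | no  _   | yes d≡b = inj₂ d≡b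
  ... | no  d≢a | no d≢b  = contradiction
    (c , a , b , d , (ca , cb , cd) , a≢b , (λ eq → d≢a (sym eq)) , (λ eq → d≢b (sym eq))) ¬claw

-- Connected subgraphs of a cycle

-- Finds where an arc stops: `f e` will say whether its edge number `e` is present.
firstFalse : (f : ℕ → Bool) → ∀ N → f N ≡ false →
  ∃ λ d → d ≤ N × f d ≡ false × (∀ e → e < d → f e ≡ true)
firstFalse f N fN with f 0 in f0
firstFalse f N       fN | false = 0 , z≤n , f0 , λ _ ()
firstFalse f zero    fN | true  = contradiction (trans (sym f0) fN) λ ()
firstFalse f (suc N) fN | true  with firstFalse (λ a → f (suc a)) N fN
... | d , d≤ , fd , below = suc d , s≤s d≤ , fd , λ { zero _ → f0 ; (suc e) (s≤s e<) → below e e< }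

-- Vertices are treated as residues modulo `n`. With `n = suc N` the modulus is visibly nonzero and
-- `n ∸ 1` reduces to `N`.
module Arcs (N : ℕ) where

  n : ℕ
  n = suc N

  shift : Fin n → ℕ → Fin n
  shift s e = (toℕ s + e) mod n

  toℕ-shift : ∀ s e → toℕ (shift s e) ≡ (toℕ s + e) % n
  toℕ-shift s e = toℕ-fromℕ< (m%n<n (toℕ s + e) n)

  [m%n+o]%n : ∀ m o → (m % n + o) % n ≡ (m + o) % n
  [m%n+o]%n m o = begin
    (m % n + o) % n           ≡⟨ %-distribˡ-+ (m % n) o n ⟩
    (m % n % n + o % n) % n   ≡⟨ cong (λ z → (z + o % n) % n) (m%n%n≡m%n m n) ⟩
    (m % n + o % n) % n       ≡⟨ %-distribˡ-+ m o n ⟨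
    (m + o) % n               ∎
    where open ≡-Reasoning

  shift-+ : ∀ s e f → shift (shift s e) f ≡ shift s (e + f)
  shift-+ s e f = toℕ-injective (begin
    toℕ (shift (shift s e) f)    ≡⟨ toℕ-shift (shift s e) f ⟩
    (toℕ (shift s e) + f) % n    ≡⟨ cong (λ z → (z + f) % n) (toℕ-shift s e) ⟩
    ((toℕ s + e) % n + f) % n    ≡⟨ [m%n+o]%n (toℕ s + e) f ⟩
    (toℕ s + e + f) % n          ≡⟨ cong (_% n) (+-assoc (toℕ s) e f) ⟩
    (toℕ s + (e + f)) % n        ≡⟨ toℕ-shift s (e + f) ⟨
    toℕ (shift s (e + f))        ∎)
    where open ≡-Reasoning

  shift-0 : ∀ s → shift s 0 ≡ s
  shift-0 s = toℕ-injective (trans (toℕ-shift s 0)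
    (trans (cong (_% n) (+-identityʳ (toℕ s))) (m<n⇒m%n≡m (toℕ<n s))))

  shift-n : ∀ s → shift s n ≡ s
  shift-n s = toℕ-injective (trans (toℕ-shift s n)
    (trans ([m+n]%n≡m%n (toℕ s) n) (m<n⇒m%n≡m (toℕ<n s))))

  -- Adding `N` is subtracting 1 modulo `n`, so `prev` is a shift as well.
  next prev : Fin n → Fin n
  next s = shift s 1
  prev s = shift s N

  next-shift : ∀ s e → next (shift s e) ≡ shift s (suc e)
  next-shift s e = trans (shift-+ s e 1) (cong (shift s) (+-comm e 1))

  prev-next : ∀ s → prev (next s) ≡ s
  prev-next s = trans (shift-+ s 1 N) (shift-n s)

  next-prev : ∀ s → next (prev s) ≡ s
  next-prev s = trans (next-shift s N) (shift-n s)

  next-injective : ∀ {s t} → next s ≡ next t → s ≡ t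
  next-injective {s} {t} eq = trans (sym (prev-next s)) (trans (cong prev eq) (prev-next t))

  shift-transitive : ∀ s t → ∃ λ e → shift s e ≡ t
  -- From `s` forward to `n`, which is 0 modulo `n`, and then on to `t`.
  shift-transitive s t = n ∸ toℕ s + toℕ t , toℕ-injective (begin
    toℕ (shift s (n ∸ toℕ s + toℕ t))    ≡⟨ toℕ-shift s _ ⟩
    (toℕ s + (n ∸ toℕ s + toℕ t)) % n    ≡⟨ cong (_% n) (+-assoc (toℕ s) (n ∸ toℕ s) (toℕ t)) ⟨
    (toℕ s + (n ∸ toℕ s) + toℕ t) % n    ≡⟨ cong (λ z → (z + toℕ t) % n) (m+[n∸m]≡n (<⇒≤ (toℕ<n s))) ⟩
    (n + toℕ t) % n                      ≡⟨ cong (_% n) (+-comm n (toℕ t)) ⟩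
    (toℕ t + n) % n                      ≡⟨ [m+n]%n≡m%n (toℕ t) n ⟩
    toℕ t % n                            ≡⟨ m<n⇒m%n≡m (toℕ<n t) ⟩
    toℕ t                                ∎)
    where open ≡-Reasoning

  next-suc : ∀ {i j : Fin n} → suc (toℕ i) ≡ toℕ j → j ≡ next i
  next-suc {i} {j} eq = toℕ-injective (trans (sym (m<n⇒m%n≡m (toℕ<n j)))
    (trans (cong (_% n) (trans (sym eq) (+-comm 1 (toℕ i)))) (sym (toℕ-shift i 1))))

  next-last : ∀ {i j : Fin n} → toℕ i ≡ 0 → toℕ j ≡ N → i ≡ next j
  next-last {i} {j} i≡0 j≡N = toℕ-injective (trans i≡0 (sym (trans (toℕ-shift j 1)
    (trans (cong (_% n) (trans (+-comm (toℕ j) 1) (cong suc j≡N))) (n%n≡0 n)))))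

  -- Modulo `n` the two wrap-around alternatives become ordinary successor steps.
  cycle⇒next : ∀ i j → cycle n i j ≡ true → j ≡ next i ⊎ i ≡ next j
  cycle⇒next i j e with Equivalence.to (cycle⇔ {n} {i} {j}) e
  ... | inj₁ eq                       = inj₁ (next-suc eq)
  ... | inj₂ (inj₁ eq)                = inj₂ (next-suc eq)
  ... | inj₂ (inj₂ (inj₁ (i≡0 , j≡N))) = inj₂ (next-last i≡0 j≡N)
  ... | inj₂ (inj₂ (inj₂ (j≡0 , i≡N))) = inj₁ (next-last j≡0 i≡N)

  -- In `full` no vertex of `A` lacks the edge from its predecessor. In `arc` the vertex `s` lacks
  -- it, and `d` counts the consecutive edges of `A` from `s` on; `d = N` is a spanning path.
  data Shape (A : ConnSub (cycle n)) : Set where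
    full : (∀ s → V' A s ≡ true → E' A (prev s) s ≡ true) → Shape A
    arc  : ∀ s d → d < n → V' A s ≡ true → E' A (prev s) s ≡ false →
           (∀ e → e < d → E' A (shift s e) (shift s (suc e)) ≡ true) →
           E' A (shift s d) (shift s (suc d)) ≡ false → Shape A

  shape : ∀ A → Shape A
  shape A with any? (λ s → (V' A s ≟ᵇ true) ×-dec (E' A (prev s) s ≟ᵇ false))
  ... | no none = full λ s Vs → ¬-not λ E≡ → none (s , Vs , E≡)
  -- Edge number `N` counted from `s` leads from `prev s` back to `s` and is missing, so the search
  -- stops with `d` at most `N`.
  ... | yes (s , Vs , E≡) with firstFalse (λ e → E' A (shift s e) (shift s (suc e))) N
                               (trans (cong (E' A (prev s)) (shift-n s)) E≡)
  ... | d , d≤ , stop , below = arc s d (s≤s d≤) Vs E≡ below stop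

  code : ∀ {A} → Shape A → Fin (suc (n * n))
  code (full _)               = zero
  code (arc s d d< _ _ _ _)   = suc (combine s (fromℕ< d<))

  -- With a vertex, `A` contains the edge from its predecessor and hence the predecessor; going
  -- backwards around the cycle reaches every `t`.
  full-all : ∀ (A : ConnSub (cycle n)) → (∀ s → V' A s ≡ true → E' A (prev s) s ≡ true) → ∀ t → V' A t ≡ true
  full-all A closed t with nonempty A
  ... | v , Vv with shift-transitive t v
  ... | e , refl = back e Vv
    where
    back : ∀ e → V' A (shift t e) ≡ true → V' A t ≡ true
    back zero    h = trans (cong (V' A) (sym (shift-0 t))) h
    back (suc e) h = back e (trans
      (cong (V' A) (trans (sym (prev-next (shift t e))) (cong prev (next-shift t e))))
      (E'-ends A _ _ (closed _ h)))

  full-edges : ∀ (A : ConnSub (cycle n)) → (∀ s → V' A s ≡ true → E' A (prev s) s ≡ true) →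
    ∀ i j → cycle n i j ≡ true → E' A i j ≡ true
  full-edges A closed i j e = [ (λ { refl → forward i })
    , (λ { refl → trans (E'-sym A _ _) (forward j) }) ] (cycle⇒next i j e)
    where
    forward : ∀ i → E' A i (next i) ≡ true
    forward i = trans (cong (λ z → E' A z (next i)) (sym (prev-next i)))
      (closed (next i) (full-all A closed (next i)))

  module _ (A : ConnSub (cycle n)) {s d} (Vs : V' A s ≡ true) (first : E' A (prev s) s ≡ false)
    (below : ∀ e → e < d → E' A (shift s e) (shift s (suc e)) ≡ true)
    (stop : E' A (shift s d) (shift s (suc d)) ≡ false) where

    OnArc : Fin n → Set
    OnArc x = ∃ λ e → e ≤ d × shift s e ≡ x

    arc-step : ∀ {e} → e ≤ d → E' A (shift s e) (shift s (suc e)) ≡ true → e < d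
    arc-step e≤ E≡ with m≤n⇒m<n∨m≡n e≤
    ... | inj₁ e<   = e<
    ... | inj₂ refl = contradiction (trans (sym E≡) stop) λ ()

    -- An edge of `A` leaving the arc would be the edge after position `d` or the edge before `s`,
    -- and both are missing.
    arc-closed : ∀ {x y} → OnArc x → E' A x y ≡ true → OnArc y
    arc-closed {y = y} (e , e≤ , refl) E≡ with cycle⇒next (shift s e) y (E'⊆E A _ _ E≡)
    ... | inj₁ refl = suc e , arc-step e≤ (trans (cong (E' A (shift s e)) (sym (next-shift s e))) E≡)
                    , sym (next-shift s e)
    arc-closed {y = y} (zero , _ , refl) E≡ | inj₂ eq = contradiction (trans (sym
        (subst₂ (λ a b → E' A a b ≡ true)
          (next-injective (trans (trans (sym eq) (shift-0 s)) (sym (next-prev s)))) (shift-0 s)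
          (trans (E'-sym A _ _) E≡))) first) λ ()
    arc-closed (suc e , e< , refl) E≡ | inj₂ eq = e , <⇒≤ e< ,
      next-injective (trans (next-shift s e) eq)

    vertex⇒onArc : ∀ {x} → V' A x ≡ true → OnArc x
    vertex⇒onArc Vx = walk-closed OnArc arc-closed (conn A _ _ Vs Vx) (0 , z≤n , shift-0 s)

    onArc⇒vertex : ∀ {x} → OnArc x → V' A x ≡ true
    onArc⇒vertex (zero  , _  , refl) = trans (cong (V' A) (shift-0 s)) Vs
    onArc⇒vertex (suc e , e< , refl) = E'-ends A _ _ (trans (E'-sym A _ _) (below e e<))

  -- Two full subgraphs are both the whole cycle. For arcs, `s` and `d` determine the vertices, and
  -- the edges are exactly the links in positions below `d`.
  code-injective : ∀ {A B} (a : Shape A) (b : Shape B) → code a ≡ code b → A ≈ₛ B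
  code-injective {A} {B} (full a) (full b) _ =
    (λ i → trans (full-all A a i) (sym (full-all B b i))) , λ i j →
      bool-ext (λ e → full-edges B b i j (E'⊆E A i j e)) (λ e → full-edges A a i j (E'⊆E B i j e))
  code-injective {A} {B} (arc s d d< Va fa ba sa) (arc s′ d′ d′< Vb fb bb sb) eq
    with combine-injective s (fromℕ< d<) s′ (fromℕ< d′<) (Fin-suc-injective eq)
  ... | refl , d≡d′ with fromℕ<-injective d d′ d< d′< d≡d′
  ... | refl = (λ i → bool-ext
      (λ V → onArc⇒vertex B Vb fb bb sb (vertex⇒onArc A Va fa ba sa V))
      (λ V → onArc⇒vertex A Va fa ba sa (vertex⇒onArc B Vb fb bb sb V))) , λ i j →
      bool-ext (edges A B Va fa ba sa bb) (edges B A Vb fb bb sb ba)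
    where
    edges : ∀ (A B : ConnSub (cycle n)) → V' A s ≡ true → E' A (prev s) s ≡ false →
      (∀ e → e < d → E' A (shift s e) (shift s (suc e)) ≡ true) →
      E' A (shift s d) (shift s (suc d)) ≡ false →
      (∀ e → e < d → E' B (shift s e) (shift s (suc e)) ≡ true) →
      ∀ {i j} → E' A i j ≡ true → E' B i j ≡ true
    edges A B V f b st b′ {i} {j} E≡ = [ (λ { refl → forward E≡ })
      , (λ { refl → trans (E'-sym B _ _) (forward (trans (E'-sym A _ _) E≡)) }) ]
      (cycle⇒next i j (E'⊆E A i j E≡))
      where
      forward : ∀ {i} → E' A i (next i) ≡ true → E' B i (next i) ≡ true
      forward {i} E≡ with vertex⇒onArc A V f b st (E'-ends A _ _ E≡)
      ... | e , e≤ , refl = trans (cong (E' B (shift s e)) (next-shift s e))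
        (b′ e (arc-step A V f b st e≤ (trans (cong (E' A (shift s e)) (sym (next-shift s e))) E≡)))

coreIndex-cycle≤ : ∀ N {m} → CoreIndexIs (cycle (suc N)) m → m ≤ suc (suc N * suc N)
coreIndex-cycle≤ N J = coreIndex≤ J (λ A → code (shape A)) λ A B → code-injective (shape A) (shape B)
  where open Arcs N

-- Isomorphic graphs

-- Subgraphs are transported along the inverse of the isomorphism. One inequality is enough, as the
-- lower bound on the core index of `G` gives the other.
coreIndex-≅ : ∀ {n} {G H : Graph n} {k m} → G ≅ H → CoreIndexIs G k → CoreIndexIs H m → k ≤ m
coreIndex-≅ {n} {G} {H} (σ , iso) I J = coreIndex-mono I J φ λ A B (V≡ , E≡) →
  (λ i → subst (λ z → V' A z ≡ V' B z) (permInverseˡ σ) (V≡ (σ ⟨$⟩ʳ i))) ,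
  (λ i j → subst₂ (λ y z → E' A y z ≡ E' B y z) (permInverseˡ σ) (permInverseˡ σ)
    (E≡ (σ ⟨$⟩ʳ i) (σ ⟨$⟩ʳ j)))
  where
  τ : Fin n → Fin n
  τ = σ ⟨$⟩ˡ_
  φ : ConnSub G → ConnSub H
  φ A = record
    { V' = λ i → V' A (τ i)
    ; E' = E
    ; E'-sym = λ i j → E'-sym A (τ i) (τ j)
    ; E'⊆E = λ i j e → trans (sym (trans (iso (τ i) (τ j))
        (cong₂ H (permInverseʳ σ) (permInverseʳ σ)))) (E'⊆E A (τ i) (τ j) e)
    ; E'-ends = λ i j → E'-ends A (τ i) (τ j)
    ; nonempty = let (i , Vi) = nonempty A in
        σ ⟨$⟩ʳ i , trans (cong (V' A) (permInverseˡ σ)) Vi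
    ; conn = λ x y Vx Vy → subst₂ (Walk E) (permInverseʳ σ) (permInverseʳ σ)
        (mapʷ (σ ⟨$⟩ʳ_) (λ e → trans (cong₂ (E' A) (permInverseˡ σ) (permInverseˡ σ)) e)
          (conn A (τ x) (τ y) Vx Vy))
    }
    where
    E : Graph n
    E i j = E' A (τ i) (τ j)

-- Comparison of the core indices of `G` and the cycle.

theorem5p15 : (n : ℕ) → 5 ≤ n → (G : Graph n) → IsSimple G → TwoConnected G →
    (k m : ℕ) → CoreIndexIs G k → CoreIndexIs (cycle n) m →
    (m ≤ k) × ((k ≡ m) ⇔ (G ≅ cycle n))
theorem5p15 (suc N) _ G simple twoConn k m I J = m≤k , mk⇔ k≡m⇒≅ λ G≅C → ≤-antisym (coreIndex-≅ G≅C I J) m≤k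
  where
  open TwoConnectedGraph simple twoConn
  m≤k : m ≤ k
  m≤k = ≤-trans (coreIndex-cycle≤ N J) (coreIndex≥ I pathsAndWhole pathsAndWhole-injective)
  k≡m⇒≅ : k ≡ m → G ≅ cycle (suc N)
  k≡m⇒≅ refl with claw?
  ... | no  ¬claw = clawFree⇒≅cycle simple twoConn ¬claw
  -- A claw would give `n * n + 2` distinct subgraphs of `G`, while `k = m` is at most `n * n + 1`.
  ... | yes (c , a , b , d , cl) = contradiction
    (≤-trans (coreIndex≥ I (clawPathsAndWhole cl) (clawPathsAndWhole-injective cl)) (coreIndex-cycle≤ N J))
    (<-irrefl refl)
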